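{- For every $k\in\mathbb{N}$ there is a CBGT instance $(E,\mathcal{I},g)$ with $n=|E|=2^k-1$ elements such that every infinite valid schedule $\pi$ for it satisfies $h(\pi)\ge \frac12\log_2(n+1)-\frac12$.
   Context: An instance of Combinatorial Bamboo Garden Trimming (CBGT) is a triple $(E,\mathcal{I},g)$ where $E$ is a finite set (of "bamboos"), $\mathcal{I}\subseteq 2^E$ is a family of subsets of $E$, and $g\in\mathbb{Q}_{\ge 0}^E$ is a vector of growth rates such that there are coefficients $\lambda(I)\ge 0$ ($I\in\mathcal{I}$) with $\sum_{I\in\mathcal{I}}\lambda(I)=1$ and $g(e)=\sum_{I\in\mathcal{I}:\, e\in I}\lambda(I)$ for every $e\in E$. Let $\mathbb{N}=\{1,2,\dots\}$. An infinite schedule is a sequence $\pi=\pi(1),\pi(2),\dots$ of subsets of $E$; it is valid if $\pi(t)\in\mathcal{I}$ for all $t\in\mathbb{N}$. $h^\pi_t(e)$ denotes the height of $e$ on day $t$ after growing but before $\pi(t)$ is cut, i.e. $h^\pi_1(e)=g(e)$, and $h^\pi_{t+1}(e)=g(e)$ if $e\in\pi(t)$, $h^\pi_{t+1}(e)=h^\pi_t(e)+g(e)$ otherwise. The height of $\pi$ is $h(\pi)=\max_{e\in E}\sup_{t\in\mathbb{N}}h^\pi_t(e)$. -}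

module Defs where

open import Data.Bool.Base using (if_then_else_)
open import Data.Fin.Base using (Fin)
open import Data.Fin.Subset using (Subset)
open import Data.Fin.Subset.Properties using (_∈?_)
open import Data.Integer.Base using (+_; -[1+_])
open import Data.List.Base using (List; foldr; map; filter)
open import Data.List.Membership.Propositional using (_∈_)
open import Data.List.Relation.Unary.Unique.Propositional using (Unique)
open import Data.Nat.Base as ℕ using (ℕ; zero; suc)
open import Data.Product.Base using (∃-syntax; _×_)
open import Data.Rational.Base using (ℚ; 0ℚ; 1ℚ; _+_; _≤_; _<_; ↥_; ↧ₙ_)
open import Relation.Binary.PropositionalEquality.Core using (_≡_)
open import Relation.Nullary.Decidable.Core using (does)

-- Extended reals as lower cuts: x is represented by the predicate "q < x" on
-- rationals q.  The cut that always holds is +∞.  A supremum, or a maximum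
-- over a nonempty finite set, is a union of cuts.

LowerReal : Set₁
LowerReal = ℚ → Set

infix 4 _≥ᴸ_
_≥ᴸ_ : LowerReal → LowerReal → Set
x ≥ᴸ y = ∀ q → y q → x q

fromℚ : ℚ → LowerReal
fromℚ r q = q < r

⋁ : {A : Set} → (A → LowerReal) → LowerReal
⋁ x q = ∃[ a ] x a q

-- q < x / 2  iff  2q < x
½·_ : LowerReal → LowerReal
(½· x) q = x (q + q)

-- q < x - r  iff  q + r < x
infixl 6 _-ᴸ_
_-ᴸ_ : LowerReal → ℚ → LowerReal
(x -ᴸ r) q = x (q + r)

-- p / b < log₂ m  iff  2 ^ p < m ^ b  (b > 0); for negative p both sides are
-- multiplied by 2 ^ (- p).
log₂ : ℕ → LowerReal
log₂ m q with ↥ q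
... | + p      = 2 ℕ.^ p ℕ.< m ℕ.^ ↧ₙ q
... | -[1+ p ] = 1 ℕ.< 2 ℕ.^ suc p ℕ.* m ℕ.^ ↧ₙ q

sumOver : {A : Set} → List A → (A → ℚ) → ℚ
sumOver xs f = foldr _+_ 0ℚ (map f xs)

-- The ground set E is Fin n; the family 𝓘 ⊆ 2^E is a list without repetitions.
record CBGT : Set where
  field
    n        : ℕ
    𝓘        : List (Subset n)
    𝓘-unique : Unique 𝓘
    g        : Fin n → ℚ
    g≥0      : ∀ e → 0ℚ ≤ g e
    convex   : ∃[ coeff ] (∀ I → I ∈ 𝓘 → 0ℚ ≤ coeff I)
                        × (sumOver 𝓘 coeff ≡ 1ℚ)
                        × (∀ e → g e ≡ sumOver (filter (e ∈?_) 𝓘) coeff)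

-- Days are numbered from 1, so index t : ℕ stands for day t + 1.
module _ (G : CBGT) where
  open CBGT G

  Schedule : Set
  Schedule = ℕ → Subset n

  Valid : Schedule → Set
  Valid π = ∀ t → π t ∈ 𝓘

  heightOn : Schedule → ℕ → Fin n → ℚ
  heightOn π zero    e = g e
  heightOn π (suc t) e =
    if does (e ∈? π t) then g e else heightOn π t e + g e

  height : Schedule → LowerReal
  height π = ⋁ λ e → ⋁ λ t → fromℚ (heightOn π t e)

-- The ground set is the set of nonzero vectors of F₂ᵏ and the cuttable sets are
-- the complements of hyperplanes (and ∅).  A uniformly random linear functional
-- is nonzero at a given nonzero vector with probability ½, so all growth rates
-- are ½.  Any k - 1 functionals have a common nonzero zero, hence some bamboo is
-- not cut on the first k - 1 days and has height k / 2 on day k.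
module Submission where

open import Algebra.Bundles using (CommutativeMonoid; CommutativeRing)
import Algebra.Properties.CommutativeMonoid.Mult as CommutativeMonoidMult
import Algebra.Properties.CommutativeSemigroup as CommutativeSemigroupProperties
import Algebra.Properties.Monoid.Mult as MonoidMult
import Algebra.Properties.Semiring.Mult as SemiringMult
open import Data.Bool.Base using (Bool; true; false; if_then_else_; not; _∧_; _xor_)
open import Data.Bool.Properties
  using (∧-zeroʳ; ∧-identityʳ; xor-same; xor-∧-commutativeRing; ¬-not)
  renaming (_≟_ to _≟ᵇ_)
open import Data.Fin.Base using (Fin; zero; suc; toℕ; fromℕ<; _↑ˡ_; _↑ʳ_; punchIn; punchOut; splitAt)
open import Data.Fin.Properties
  using (any?; punchIn-punchOut; toℕ-fromℕ<; splitAt⁻¹-↑ˡ; splitAt⁻¹-↑ʳ)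
  renaming (_≟_ to _≟ᶠ_)
open import Data.Fin.Subset using (Subset)
open import Data.Fin.Subset.Properties using (_∈?_)
open import Data.Integer.Base as ℤ using (-[1+_])
import Data.Integer.Properties as ℤ
open import Data.List.Base using (List; []; _∷_; [_]; _++_; map; filter; length; cartesianProductWith)
open import Data.List.Properties using (length-map; length-++; ++-identityʳ; filter-++)
open import Data.List.Membership.Propositional.Properties using (∈-map⁻)
open import Data.List.Relation.Unary.All using ([]; _∷_)
open import Data.List.Relation.Unary.AllPairs using ([]; _∷_)
open import Data.List.Relation.Unary.Unique.Propositional using (Unique)
open import Data.List.Relation.Unary.Unique.Propositional.Properties using (map⁺; cartesianProductWith⁺)
open import Data.Nat.Base as ℕ using (ℕ; zero; suc; _≥_; _^_; _∸_; s≤s; z≤n)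
import Data.Nat.Properties as ℕ
open import Data.Product.Base using (∃-syntax; _×_; _,_; proj₁; proj₂)
open import Data.Rational.Base using (ℚ; 0ℚ; 1ℚ; ½; _+_; _*_; _≤_; _<_; *≤*; *<*; ↥_; ↧_; ↧ₙ_)
open import Data.Rational.Literals using (fromℤ)
import Data.Rational.Properties as ℚ
open import Data.Rational.Unnormalised.Base using (*≡*)
import Data.Rational.Unnormalised.Properties as ℚᵘ
open import Data.Sum.Base using (inj₁; inj₂)
open import Data.Vec.Base as Vec using (Vec; lookup; zipWith; head; tail)
  renaming ([] to []ᵛ; _∷_ to _∷ᵛ_; _++_ to _++ᵛ_)
open import Data.Vec.Properties
  using (lookup-++ˡ; lookup-++ʳ; lookup-map; ++-injectiveˡ; ++-injectiveʳ; ∷-injective; ∷-injectiveˡ)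
open import Function.Base using (_∘_; const)
open import Level using (0ℓ)
open import Relation.Binary.PropositionalEquality
  using (_≡_; _≢_; _≗_; refl; sym; trans; cong; cong₂; subst; module ≡-Reasoning)
open import Relation.Nullary.Decidable.Core using (Dec; does; yes; no)
open import Relation.Unary using (Pred; Decidable)
open import Defs

open CommutativeSemigroupProperties ℕ.+-commutativeSemigroup
  using () renaming (interchange to ℕ-interchange)
open CommutativeSemigroupProperties
  (CommutativeMonoid.commutativeSemigroup (CommutativeRing.+-commutativeMonoid xor-∧-commutativeRing))
  using () renaming (interchange to xor-interchange)
open MonoidMult ℚ.+-0-monoid using (×-homo-+) renaming (_×_ to _·_)
open CommutativeMonoidMult ℚ.+-0-commutativeMonoid using (×-distrib-+)
open SemiringMult (CommutativeRing.semiring ℚ.+-*-commutativeRing) using (×-comm-*)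

-- Membership tests and constant sums over lists

-- Turns the cut test in `heightOn` and the filter in the growth condition into a bit of the set,
-- hence into the value of a functional.
does-∈? : ∀ {n} (e : Fin n) (p : Subset n) → does (e ∈? p) ≡ lookup p e
does-∈? zero    (true  ∷ᵛ p) = refl
does-∈? zero    (false ∷ᵛ p) = refl
does-∈? (suc e) (_ ∷ᵛ p)     = does-∈? e p

length-filter-map : ∀ {A B : Set} {P : Pred B 0ℓ} (P? : Decidable P) (f : A → B) xs →
                    length (filter P? (map f xs)) ≡ length (filter (P? ∘ f) xs)
length-filter-map P? f []       = refl
length-filter-map P? f (x ∷ xs) with does (P? (f x))
... | true  = cong suc (length-filter-map P? f xs)
... | false = length-filter-map P? f xs

sumOver-const : ∀ {A : Set} (xs : List A) c → sumOver xs (const c) ≡ length xs · c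
sumOver-const []       c = refl
sumOver-const (x ∷ xs) c = cong (λ q → c + q) (sumOver-const xs c)

-- Nonzero vectors as positions, functionals as subsets

-- This is 2ᵏ - 1. The recursion mirrors the three blocks of positions, so the concatenation in
-- `encode` has the right length by definition.
size : ℕ → ℕ
size zero    = zero
size (suc k) = size k ℕ.+ suc (size k)

double : ∀ k → 2 ^ k ℕ.+ 2 ^ k ≡ 2 ^ suc k
double k = cong (2 ^ k ℕ.+_) (sym (ℕ.+-identityʳ (2 ^ k)))

suc-size : ∀ k → suc (size k) ≡ 2 ^ k
suc-size zero    = refl
suc-size (suc k) = trans (cong₂ ℕ._+_ (suc-size k) (suc-size k)) (double k)

-- The positions enumerate the nonzero vectors x = (x₀ , x') of F₂ᵏ, first those with
-- x₀ = 0, then (1 , 0), then (1 , x') with x' ≠ 0; the entry of encode a at x is a · x.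
encode : ∀ {k} → Vec Bool k → Subset (size k)
encode []ᵛ      = []ᵛ
encode (b ∷ᵛ a) = encode a ++ᵛ (b ∷ᵛ Vec.map (b xor_) (encode a))

-- The block with x₀ = 0 determines the remaining coefficients, and the entry at (1 , 0) is the
-- first coefficient.
encode-injective : ∀ {k} {a b : Vec Bool k} → encode a ≡ encode b → a ≡ b
encode-injective {a = []ᵛ}    {[]ᵛ}    eq = refl
encode-injective {a = x ∷ᵛ a} {y ∷ᵛ b} eq =
  cong₂ _∷ᵛ_ (∷-injectiveˡ (++-injectiveʳ (encode a) (encode b) eq))
             (encode-injective (++-injectiveˡ (encode a) (encode b) eq))

-- The dot product a · x over F₂, where x is the nonzero vector at position `e`.
_⟨_⟩ : ∀ {k} → Vec Bool k → Fin (size k) → Bool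
a ⟨ e ⟩ = lookup (encode a) e


module _ {k} (b : Bool) (a : Vec Bool k) where

  ⟨⟩-left : ∀ e → (b ∷ᵛ a) ⟨ e ↑ˡ suc (size k) ⟩ ≡ a ⟨ e ⟩
  ⟨⟩-left e = lookup-++ˡ (encode a) _ e

  ⟨⟩-middle : (b ∷ᵛ a) ⟨ size k ↑ʳ zero ⟩ ≡ b
  ⟨⟩-middle = lookup-++ʳ (encode a) _ zero

  ⟨⟩-right : ∀ e → (b ∷ᵛ a) ⟨ size k ↑ʳ suc e ⟩ ≡ b xor (a ⟨ e ⟩)
  ⟨⟩-right e = trans (lookup-++ʳ (encode a) _ (suc e)) (lookup-map e (b xor_) (encode a))

data Position k : Fin (size (suc k)) → Set where
  left   : ∀ e → Position k (e ↑ˡ suc (size k))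
  middle : Position k (size k ↑ʳ zero)
  right  : ∀ e → Position k (size k ↑ʳ suc e)

position : ∀ k (e : Fin (size (suc k))) → Position k e
position k e with splitAt (size k) e in eq
... | inj₁ i       = subst (Position k) (splitAt⁻¹-↑ˡ eq) (left i)
... | inj₂ zero    = subst (Position k) (splitAt⁻¹-↑ʳ {size k} eq) middle
... | inj₂ (suc i) = subst (Position k) (splitAt⁻¹-↑ʳ {size k} eq) (right i)

-- Linearity and common zeros of functionals

_⊕_ : ∀ {k} → Vec Bool k → Vec Bool k → Vec Bool k
_⊕_ = zipWith _xor_

-- The position of (x , x') when `e` is that of x'. As x' is nonzero, the middle position (1 , 0)
-- never arises.
prepend : ∀ k → Bool → Fin (size k) → Fin (size (suc k))
prepend k false e = e ↑ˡ suc (size k)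
prepend k true  e = size k ↑ʳ suc e

⟨⟩-prepend : ∀ {k} b (a : Vec Bool k) x e → (b ∷ᵛ a) ⟨ prepend k x e ⟩ ≡ (b ∧ x) xor a ⟨ e ⟩
⟨⟩-prepend b a false e rewrite ∧-zeroʳ b     = ⟨⟩-left b a e
⟨⟩-prepend b a true  e rewrite ∧-identityʳ b = ⟨⟩-right b a e

⟨⟩-⊕ : ∀ {k} (a b : Vec Bool k) e → (a ⊕ b) ⟨ e ⟩ ≡ a ⟨ e ⟩ xor b ⟨ e ⟩
⟨⟩-⊕ {suc k} (x ∷ᵛ a) (y ∷ᵛ b) e with position k e
... | left i
  rewrite ⟨⟩-left (x xor y) (a ⊕ b) i | ⟨⟩-left x a i | ⟨⟩-left y b i = ⟨⟩-⊕ a b i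
... | middle
  rewrite ⟨⟩-middle (x xor y) (a ⊕ b) | ⟨⟩-middle x a | ⟨⟩-middle y b = refl
... | right i
  rewrite ⟨⟩-right (x xor y) (a ⊕ b) i | ⟨⟩-right x a i | ⟨⟩-right y b i | ⟨⟩-⊕ a b i
  = xor-interchange x y (a ⟨ i ⟩) (b ⟨ i ⟩)

-- Gaussian elimination on the first coordinate: if no functional involves it, the
-- vector (1 , 0) works; otherwise it is eliminated with a pivot (1 , c), and a common zero
-- of the remaining functionals lifts by choosing the first coordinate so that the pivot
-- vanishes.
common-zero : ∀ {k m} → m ℕ.< k → (a : Fin m → Vec Bool k) → ∃[ e ] (∀ i → a i ⟨ e ⟩ ≡ false)
common-zero {suc k} {zero}  _         a = size k ↑ʳ zero , λ ()
common-zero {suc k} {suc m} (s≤s m<k) a with any? (λ i → head (a i) ≟ᵇ true)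
... | no ¬pivot = size k ↑ʳ zero , λ i → vanishes (a i) (λ eq → ¬pivot (i , eq))
  where
  vanishes : ∀ d → head d ≢ true → d ⟨ size k ↑ʳ zero ⟩ ≡ false
  vanishes (b ∷ᵛ d) b≢true = trans (⟨⟩-middle b d) (¬-not b≢true)
... | yes (p , head≡true) = prepend k (c ⟨ e ⟩) e , λ i → vanishes i (p ≟ᶠ i)
  where
  c : Vec Bool k
  c = tail (a p)

  eliminate : Vec Bool (suc k) → Vec Bool k
  eliminate (false ∷ᵛ d) = d
  eliminate (true  ∷ᵛ d) = c ⊕ d

  rest : ∃[ e ] (∀ j → eliminate (a (punchIn p j)) ⟨ e ⟩ ≡ false)
  rest = common-zero m<k (λ j → eliminate (a (punchIn p j)))

  e : Fin (size k)
  e = proj₁ rest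

  -- The first coordinate `c ⟨ e ⟩` of the lifted vector contributes to `d` exactly when `d` has
  -- leading coefficient 1, and then it is the same term that adding `c` contributes.
  eliminate-⟨⟩ : ∀ d → d ⟨ prepend k (c ⟨ e ⟩) e ⟩ ≡ eliminate d ⟨ e ⟩
  eliminate-⟨⟩ (false ∷ᵛ d) = ⟨⟩-prepend false d (c ⟨ e ⟩) e
  eliminate-⟨⟩ (true  ∷ᵛ d) = trans (⟨⟩-prepend true d (c ⟨ e ⟩) e) (sym (⟨⟩-⊕ c d e))

  pivot-vanishes : ∀ d → head d ≡ true → d ⟨ prepend k (tail d ⟨ e ⟩) e ⟩ ≡ false
  pivot-vanishes (true ∷ᵛ d) refl = trans (⟨⟩-prepend true d (d ⟨ e ⟩) e) (xor-same (d ⟨ e ⟩))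

  vanishes : ∀ i → Dec (p ≡ i) → a i ⟨ prepend k (c ⟨ e ⟩) e ⟩ ≡ false
  vanishes i (yes refl) = pivot-vanishes (a p) head≡true
  vanishes i (no p≢i)   = trans (eliminate-⟨⟩ (a i))
    (subst (λ i → eliminate (a i) ⟨ e ⟩ ≡ false) (punchIn-punchOut p≢i)
           (proj₂ rest (punchOut p≢i)))

-- Counting functionals that are nonzero at a given vector

vectors : ∀ k → List (Vec Bool k)
vectors zero    = [ []ᵛ ]
vectors (suc k) = cartesianProductWith _∷ᵛ_ (false ∷ true ∷ []) (vectors k)

vectors-unique : ∀ k → Unique (vectors k)
vectors-unique zero    = [] ∷ []
vectors-unique (suc k) =
  cartesianProductWith⁺ _∷ᵛ_ ∷-injective (((λ ()) ∷ []) ∷ [] ∷ []) (vectors-unique k)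

-- The number of vectors at which `f` is true. Splitting on the first coordinate matches the blocks
-- of `encode`, so counts can be found by induction on the dimension.
# : ∀ {k} → (Vec Bool k → Bool) → ℕ
# {zero}  f = if f []ᵛ then 1 else 0
# {suc k} f = # (f ∘ (false ∷ᵛ_)) ℕ.+ # (f ∘ (true ∷ᵛ_))

length-filter-vectors : ∀ {k} {P : Pred (Vec Bool k) 0ℓ} (P? : Decidable P) →
                        length (filter P? (vectors k)) ≡ # (does ∘ P?)
length-filter-vectors {zero} P? with does (P? []ᵛ)
... | true  = refl
... | false = refl
length-filter-vectors {suc k} P? = begin
  length (filter P? (vs₀ ++ vs₁ ++ []))
    ≡⟨ cong (λ vs → length (filter P? (vs₀ ++ vs))) (++-identityʳ vs₁) ⟩
  length (filter P? (vs₀ ++ vs₁))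
    ≡⟨ cong length (filter-++ P? vs₀ vs₁) ⟩
  length (filter P? vs₀ ++ filter P? vs₁)
    ≡⟨ length-++ (filter P? vs₀) ⟩
  length (filter P? vs₀) ℕ.+ length (filter P? vs₁)
    ≡⟨ cong₂ ℕ._+_ (half false) (half true) ⟩
  # (does ∘ P?) ∎
  where
  open ≡-Reasoning
  vs₀ = map (false ∷ᵛ_) (vectors k)
  vs₁ = map (true ∷ᵛ_) (vectors k)
  half : ∀ b → length (filter P? (map (b ∷ᵛ_) (vectors k))) ≡ # (does ∘ P? ∘ (b ∷ᵛ_))
  half b = trans (length-filter-map P? (b ∷ᵛ_) (vectors k)) (length-filter-vectors (P? ∘ (b ∷ᵛ_)))

#-cong : ∀ {k} {f g : Vec Bool k → Bool} → f ≗ g → # f ≡ # g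
#-cong {zero}  f≗g = cong (if_then 1 else 0) (f≗g []ᵛ)
#-cong {suc k} f≗g = cong₂ ℕ._+_ (#-cong (f≗g ∘ (false ∷ᵛ_))) (#-cong (f≗g ∘ (true ∷ᵛ_)))

#-false : ∀ k → # {k} (const false) ≡ 0
#-false zero    = refl
#-false (suc k) = cong₂ ℕ._+_ (#-false k) (#-false k)

#-true : ∀ k → # {k} (const true) ≡ 2 ^ k
#-true zero    = refl
#-true (suc k) = trans (cong₂ ℕ._+_ (#-true k) (#-true k)) (double k)

#-not : ∀ {k} (f : Vec Bool k → Bool) → # f ℕ.+ # (not ∘ f) ≡ 2 ^ k
#-not {zero} f with f []ᵛ
... | true  = refl
... | false = refl
#-not {suc k} f = begin
  (# f₀ ℕ.+ # f₁) ℕ.+ (# (not ∘ f₀) ℕ.+ # (not ∘ f₁))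
    ≡⟨ ℕ-interchange (# f₀) _ _ _ ⟩
  (# f₀ ℕ.+ # (not ∘ f₀)) ℕ.+ (# f₁ ℕ.+ # (not ∘ f₁))
    ≡⟨ cong₂ ℕ._+_ (#-not f₀) (#-not f₁) ⟩
  2 ^ k ℕ.+ 2 ^ k
    ≡⟨ double k ⟩
  2 ^ suc k ∎
  where
  open ≡-Reasoning
  f₀ = f ∘ (false ∷ᵛ_)
  f₁ = f ∘ (true ∷ᵛ_)

#-⟨⟩ : ∀ k (e : Fin (size (suc k))) → # {suc k} (_⟨ e ⟩) ≡ 2 ^ k
#-⟨⟩ k e with position k e
#-⟨⟩ (suc k) _ | left i = trans
  -- At (0 , x') the first coefficient has no effect, so each of its two values contributes the
  -- inductive count for x'.
  (cong₂ ℕ._+_ (trans (#-cong {suc k} (λ a → ⟨⟩-left false a i)) (#-⟨⟩ k i))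
               (trans (#-cong {suc k} (λ a → ⟨⟩-left true a i)) (#-⟨⟩ k i)))
  (double k)
#-⟨⟩ k _ | middle =
  -- At (1 , 0) the value is the first coefficient itself: all functionals of one half count, none
  -- of the other.
  cong₂ ℕ._+_ (trans (#-cong {k} (⟨⟩-middle false)) (#-false k))
              (trans (#-cong {k} (⟨⟩-middle true)) (#-true k))
#-⟨⟩ k _ | right i = trans
  -- At (1 , x') flipping the first coefficient negates the value, so the two halves count a
  -- predicate and its negation.
  (cong₂ ℕ._+_ (#-cong {k} (λ a → ⟨⟩-right false a i)) (#-cong {k} (λ a → ⟨⟩-right true a i)))
  (#-not {k} (_⟨ i ⟩))

-- Uniform weights and the instance

2⁻_ : ℕ → ℚ
2⁻ zero  = 1ℚ
2⁻ suc k = ½ * 2⁻ k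

0≤2⁻ : ∀ k → 0ℚ ≤ 2⁻ k
0≤2⁻ zero    = *≤* (ℤ.+≤+ z≤n)
0≤2⁻ (suc k) = ℚ.≤-trans (ℚ.≤-reflexive (sym (ℚ.*-zeroʳ ½))) (ℚ.*-monoˡ-≤-nonNeg ½ (0≤2⁻ k))

½+½ : ∀ q → ½ * q + ½ * q ≡ q
½+½ q = trans (sym (ℚ.*-distribʳ-+ q ½ ½)) (ℚ.*-identityˡ q)

2^·2⁻ : ∀ k → (2 ^ k) · 2⁻ k ≡ 1ℚ
2^·2⁻ zero    = refl
2^·2⁻ (suc k) = begin
  (2 ^ suc k) · 2⁻ suc k              ≡⟨ cong (_· 2⁻ suc k) (double k) ⟨
  (2 ^ k ℕ.+ 2 ^ k) · 2⁻ suc k        ≡⟨ ×-homo-+ _ (2 ^ k) (2 ^ k) ⟩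
  (2 ^ k) · 2⁻ suc k + (2 ^ k) · 2⁻ suc k ≡⟨ ×-distrib-+ _ _ (2 ^ k) ⟨
  (2 ^ k) · (2⁻ suc k + 2⁻ suc k)     ≡⟨ cong ((2 ^ k) ·_) (½+½ (2⁻ k)) ⟩
  (2 ^ k) · 2⁻ k                      ≡⟨ 2^·2⁻ k ⟩
  1ℚ                                  ∎
  where open ≡-Reasoning

-- The growth rate: half of the 2ᵏ⁺¹ functionals are nonzero at a given vector, each with weight
-- 2⁻ᵏ⁻¹.
2^·2⁻suc : ∀ k → (2 ^ k) · 2⁻ suc k ≡ ½
2^·2⁻suc k = trans (sym (×-comm-* (2 ^ k) ½ (2⁻ k))) (cong (½ *_) (2^·2⁻ k))

length-vectors : ∀ k → length (vectors k) ≡ 2 ^ k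
length-vectors zero    = refl
length-vectors (suc k) = begin
  length (map (false ∷ᵛ_) (vectors k) ++ map (true ∷ᵛ_) (vectors k) ++ [])
    ≡⟨ cong (λ vs → length (map (false ∷ᵛ_) (vectors k) ++ vs)) (++-identityʳ _) ⟩
  length (map (false ∷ᵛ_) (vectors k) ++ map (true ∷ᵛ_) (vectors k))
    ≡⟨ length-++ (map (false ∷ᵛ_) (vectors k)) ⟩
  length (map (false ∷ᵛ_) (vectors k)) ℕ.+ length (map (true ∷ᵛ_) (vectors k))
    ≡⟨ cong₂ ℕ._+_ (trans (length-map _ (vectors k)) (length-vectors k))
                   (trans (length-map _ (vectors k)) (length-vectors k)) ⟩
  2 ^ k ℕ.+ 2 ^ k
    ≡⟨ double k ⟩
  2 ^ suc k ∎
  where open ≡-Reasoning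

hyperplanes : ℕ → CBGT
hyperplanes k = record
  { n        = size k
  ; 𝓘        = map encode (vectors k)
  ; 𝓘-unique = map⁺ encode-injective (vectors-unique k)
  ; g        = const ½
  ; g≥0      = λ _ → *≤* (ℤ.+≤+ z≤n)
  ; convex   = const (2⁻ k) , (λ _ _ → 0≤2⁻ k) , total , growth k
  }
  where
  open ≡-Reasoning

  total : sumOver (map encode (vectors k)) (const (2⁻ k)) ≡ 1ℚ
  total = begin
    sumOver (map encode (vectors k)) (const (2⁻ k)) ≡⟨ sumOver-const (map encode (vectors k)) (2⁻ k) ⟩
    length (map encode (vectors k)) · 2⁻ k          ≡⟨ cong (_· 2⁻ k) (length-map encode (vectors k)) ⟩
    length (vectors k) · 2⁻ k                       ≡⟨ cong (_· 2⁻ k) (length-vectors k) ⟩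
    (2 ^ k) · 2⁻ k                                  ≡⟨ 2^·2⁻ k ⟩
    1ℚ                                              ∎

  growth : ∀ k (e : Fin (size k)) →
           ½ ≡ sumOver (filter (e ∈?_) (map encode (vectors k))) (const (2⁻ k))
  -- Dimension zero has no bamboos, so only successors remain.
  growth (suc k) e = sym (begin
    sumOver (filter (e ∈?_) (map encode (vectors (suc k)))) (const (2⁻ suc k))
      ≡⟨ sumOver-const (filter (e ∈?_) (map encode (vectors (suc k)))) (2⁻ suc k) ⟩
    length (filter (e ∈?_) (map encode (vectors (suc k)))) · 2⁻ suc k
      ≡⟨ cong (_· 2⁻ suc k) (begin
           length (filter (e ∈?_) (map encode (vectors (suc k))))
             ≡⟨ length-filter-map (e ∈?_) encode (vectors (suc k)) ⟩
           length (filter ((e ∈?_) ∘ encode) (vectors (suc k)))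
             ≡⟨ length-filter-vectors {suc k} ((e ∈?_) ∘ encode) ⟩
           # {suc k} (λ a → does (e ∈? encode a))
             ≡⟨ #-cong {suc k} (λ a → does-∈? e (encode a)) ⟩
           # {suc k} (_⟨ e ⟩)
             ≡⟨ #-⟨⟩ k e ⟩
           2 ^ k ∎) ⟩
    (2 ^ k) · 2⁻ suc k
      ≡⟨ 2^·2⁻suc k ⟩
    ½ ∎)

-- Heights of uncut bamboos and comparison with the logarithm

-- Index `t` is day t + 1, and the height is measured after that day's growth, so t days without a
-- cut give t + 1 increments of ½.
heightOn-uncut : ∀ k (π : Schedule (hyperplanes k)) e t →
                 (∀ s → s ℕ.< t → lookup (π s) e ≡ false) →
                 heightOn (hyperplanes k) π t e ≡ suc t · ½
heightOn-uncut k π e zero    uncut = refl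
heightOn-uncut k π e (suc t) uncut
  rewrite does-∈? e (π t) | uncut t (ℕ.n<1+n t)
        | heightOn-uncut k π e t (λ s s<t → uncut s (ℕ.m<n⇒m<1+n s<t))
  = ℚ.+-comm (suc t · ½) ½

·1ℚ : ∀ k → k · 1ℚ ≡ fromℤ (ℤ.+ k)
·1ℚ zero    = refl
·1ℚ (suc k) = trans (cong (λ q → 1ℚ + q) (·1ℚ k))
  (ℚ.toℚᵘ-injective (ℚᵘ.≃-trans (ℚ.toℚᵘ-homo-+ 1ℚ (fromℤ (ℤ.+ k))) (*≡* (numerators k))))
  where
  numerators : ∀ k → (ℤ.1ℤ ℤ.* ℤ.1ℤ ℤ.+ (ℤ.+ k) ℤ.* ℤ.1ℤ) ℤ.* ℤ.1ℤ ≡ (ℤ.+ suc k) ℤ.* ℤ.1ℤ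
  numerators k = cong (ℤ._* ℤ.1ℤ) (cong (λ n → ℤ.1ℤ ℤ.+ n) (ℤ.*-identityʳ (ℤ.+ k)))

-- Write q = p / b. A negative q lies below k at once. Otherwise k b ≤ p would give (2ᵏ)ᵇ ≤ 2ᵖ by
-- monotonicity of powers of 2, against the cut.
log₂-2^ : ∀ k q → log₂ (2 ^ k) q → q < fromℤ (ℤ.+ k)
log₂-2^ k q q<log with ↥ q in eq
... | -[1+ p ] = *<* (begin-strict
    ↥ q ℤ.* ℤ.1ℤ ≡⟨ ℤ.*-identityʳ (↥ q) ⟩
    ↥ q ≡⟨ eq ⟩
    -[1+ p ] <⟨ ℤ.-<+ ⟩
    ℤ.+ (k ℕ.* ↧ₙ q) ≡⟨ ℤ.pos-* k (↧ₙ q) ⟩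
    ℤ.+ k ℤ.* ↧ q ∎)
  where open ℤ.≤-Reasoning
... | ℤ.+ p = *<* (begin-strict
    ↥ q ℤ.* ℤ.1ℤ ≡⟨ ℤ.*-identityʳ (↥ q) ⟩
    ↥ q ≡⟨ eq ⟩
    ℤ.+ p <⟨ ℤ.+<+ (ℕ.≰⇒> λ kb≤p → ℕ.<⇒≱ q<log
      (subst (ℕ._≤ 2 ^ p) (sym (ℕ.^-*-assoc 2 k (↧ₙ q))) (ℕ.^-monoʳ-≤ 2 kb≤p))) ⟩
    ℤ.+ (k ℕ.* ↧ₙ q) ≡⟨ ℤ.pos-* k (↧ₙ q) ⟩
    ℤ.+ k ℤ.* ↧ q ∎)
  where open ℤ.≤-Reasoning

theorem5p4 : ∀ (k : ℕ) → k ≥ 1 →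
    ∃[ G ] (CBGT.n G ≡ 2 ^ k ∸ 1) ×
    (∀ (π : Schedule G) → Valid G π →
    height G π ≥ᴸ (½· log₂ (suc (CBGT.n G))) -ᴸ ½)
theorem5p4 (suc k) _ = hyperplanes (suc k) , cong (_∸ 1) (suc-size (suc k)) , bound
  where
  bound : ∀ (π : Schedule (hyperplanes (suc k))) → Valid (hyperplanes (suc k)) π →
          height (hyperplanes (suc k)) π ≥ᴸ (½· log₂ (suc (size (suc k)))) -ᴸ ½
  -- The witness is index `k`, day k + 1, when `e` has height (k + 1) / 2. If q were at least this,
  -- so would be `r`, and doubling would contradict `2r<k`.
  bound π valid q q<log = e , k , subst (q <_) (sym height≡) (ℚ.≰⇒> λ k/2≤q →
    ℚ.<-irrefl refl (ℚ.<-≤-trans 2r<k (subst (_≤ r + r) k/2+k/2 (ℚ.+-mono-≤ (≤r k/2≤q) (≤r k/2≤q)))))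
    where
    -- Unfolding the cuts for subtracting ½ and for halving turns the assumption on `q` into one on
    -- `r + r` for the plain logarithm.
    r : ℚ
    r = q + ½

    functional : ∀ t → ∃[ a ] π t ≡ encode a
    functional t with a , _ , eq ← ∈-map⁻ encode (valid t) = a , eq

    -- The functionals of the first `k` days number one less than the dimension `suc k`.
    zeros = common-zero (ℕ.n<1+n k) (λ i → proj₁ (functional (toℕ i)))
    e = proj₁ zeros

    uncut : ∀ s → s ℕ.< k → lookup (π s) e ≡ false
    uncut s s<k =
      subst (λ s → lookup (π s) e ≡ false) (toℕ-fromℕ< s<k)
        (trans (cong (λ p → lookup p e) (proj₂ (functional _))) (proj₂ zeros (fromℕ< s<k)))

    height≡ : heightOn (hyperplanes (suc k)) π k e ≡ suc k · ½
    height≡ = heightOn-uncut (suc k) π e k uncut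

    2r<k : r + r < fromℤ (ℤ.+ suc k)
    2r<k = log₂-2^ (suc k) (r + r) (subst (λ m → log₂ m (r + r)) (suc-size (suc k)) q<log)

    k/2+k/2 : suc k · ½ + suc k · ½ ≡ fromℤ (ℤ.+ suc k)
    k/2+k/2 = trans (sym (×-distrib-+ ½ ½ (suc k))) (·1ℚ (suc k))

    ≤r : ∀ {x} → x ≤ q → x ≤ r
    ≤r {x} x≤q = subst (_≤ r) (ℚ.+-identityʳ x) (ℚ.+-mono-≤ x≤q (*≤* (ℤ.+≤+ z≤n)))
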